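{- Let $G$ be a finite abstract simplicial complex with connection matrix $L$. Then $\det(L)=\phi(G)$, where $\phi(G)=\prod_{x\in G}\omega(x)\in\{ -1,1\}$.
   Context: A finite abstract simplicial complex $G$ is a finite set of non-empty finite sets closed under taking non-empty subsets; its elements are called simplices. For $x\in G$ let $\dim(x)=|x|-1$ and $\omega(x)=(-1)^{\dim(x)}$. The connection matrix $L$ of $G$ is the $|G|\times|G|$ matrix indexed by the simplices of $G$ with $L(x,y)=1$ if $x\cap y\neq\emptyset$ and $L(x,y)=0$ otherwise. The number $\phi(G)=\prod_{x\in G}\omega(x)$ is called the Fermi characteristic. -}

module Defs where

open import Data.Bool.Base using (if_then_else_)
open import Data.Fin.Base using (Fin; zero; suc; toℕ; punchIn)
open import Data.Fin.Subset using (Subset; Nonempty; _∩_; _⊆_; ∣_∣)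
open import Data.Fin.Subset.Properties using (nonempty?)
open import Data.Integer.Base using (ℤ; 0ℤ; 1ℤ; -1ℤ; _*_; _^_)
open import Data.Integer.Properties using (+-*-semiring)
open import Data.List.Base using (List; length; lookup; map; foldr)
open import Data.List.Membership.Propositional using () renaming (_∈_ to _∈ˡ_)
open import Data.List.Relation.Unary.Unique.Propositional using (Unique)
open import Data.Nat.Base using (ℕ; zero; suc; _∸_)
open import Relation.Nullary.Decidable.Core using (does)
open import Algebra.Properties.Semiring.Sum +-*-semiring using (sum)

-- The simplices are subsets of a labelled finite set Fin n; labels that lie in
-- no simplex are allowed.  The finite set of simplices is a duplicate-free list
-- in arbitrary order; that order indexes the rows and columns of matrices.
record SimplicialComplex (n : ℕ) : Set where
  field
    simplices : List (Subset n)
    unique    : Unique simplices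
    nonempty  : ∀ {x} → x ∈ˡ simplices → Nonempty x
    closed    : ∀ {x y} → x ∈ˡ simplices → Nonempty y → y ⊆ x → y ∈ˡ simplices

  size : ℕ
  size = length simplices

  simplex : Fin size → Subset n
  simplex = lookup simplices

open SimplicialComplex public

-- Truncated subtraction is harmless: simplices are non-empty.
dim : ∀ {n} → Subset n → ℕ
dim x = ∣ x ∣ ∸ 1

ω : ∀ {n} → Subset n → ℤ
ω x = -1ℤ ^ dim x

φ : ∀ {n} → SimplicialComplex n → ℤ
φ G = foldr _*_ 1ℤ (map ω (simplices G))

Matrix : ℕ → Set
Matrix m = Fin m → Fin m → ℤ

-- Laplace expansion along the first row.
det : ∀ {m} → Matrix m → ℤ
det {zero}  A = 1ℤ
det {suc m} A =
  sum λ j → -1ℤ ^ toℕ j * A zero j * det (λ i k → A (suc i) (punchIn j k))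

connectionMatrix : ∀ {n} (G : SimplicialComplex n) → Matrix (size G)
connectionMatrix G i j =
  if does (nonempty? (simplex G i ∩ simplex G j)) then 1ℤ else 0ℤ

{-# OPTIONS --safe #-}
-- For simplices x, y of G, every non-empty z ⊆ x ∩ y lies in G, and the signed
-- count Σ ω(z) over such z is the Euler characteristic of a simplex: 1 if x ∩ y
-- is non-empty and 0 otherwise.  Hence L = Zᵀ D Z with Z(z,x) = [z ⊆ x] and
-- D = diag(ω).  Ordered by cardinality, Z is unitriangular, so multiplying by Z
-- or Zᵀ on the left is a sequence of row operations and det L = det D.
module Submission where

open import Defs
open import Data.Bool.Base using (if_then_else_)
open import Data.Empty using (⊥-elim)
open import Data.Fin.Base using (Fin; zero; suc; toℕ; fromℕ<; combine; punchIn; punchOut) renaming (_<_ to _<ᶠ_)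
open import Data.Fin.Properties using (_≟_; any?; <-cmp; toℕ-injective; toℕ<n; toℕ-fromℕ<; combine-injectiveʳ; combine-monoˡ-<; punchInᵢ≢i; punchOut-cong; punchOut-punchIn; suc-injective)
open import Data.Fin.Subset using (Subset; inside; outside; Nonempty; _∩_; _⊆_; _⊂_; ∁; ⊥; ∣_∣)
open import Data.Fin.Subset.Properties using (nonempty?; _⊆?_; _∈?_; ⊆-refl; ⊆-antisym; ⊆-min; p∩q⊆p; p∩q⊆q; x∈p∩q⁺; Empty-unique; ∉⊥; ∣p∣≤n; ∣⊥∣≡0; p⊂q⇒∣p∣<∣q∣; p⊂q⇒∁p⊃∁q)
open import Data.Integer.Base using (ℤ; +0; +[1+_]; -[1+_]; 0ℤ; 1ℤ; -1ℤ; _+_; _*_; _^_)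
open import Data.Integer.Properties using (+-*-semiring; *-zeroʳ; +-identityˡ; +-identityʳ; *-identityˡ; *-identityʳ)
open import Data.Integer.Tactic.RingSolver using (solve-∀)
open import Data.List.Base using (List; []; _∷_; length; lookup; map; foldr)
import Data.List.Membership.DecPropositional as DecMembership
open import Data.List.Membership.Propositional using () renaming (_∈_ to _∈ˡ_)
open import Data.List.Membership.Propositional.Properties using (∈-lookup)
open import Data.List.Relation.Unary.All as All using (All)
open import Data.List.Relation.Unary.AllPairs using ([]; _∷_)
open import Data.List.Relation.Unary.Unique.Propositional using (Unique)
open import Data.Nat.Base as ℕ using (ℕ; zero; suc; s≤s)
import Data.Nat.Properties as ℕ
open import Data.Product.Base using (_×_; _,_; proj₂)
open import Data.Sum.Base using (_⊎_; inj₁; inj₂)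
open import Data.Vec.Base using ([]; _∷_; there)
open import Data.Vec.Functional using (Vector; updateAt)
open import Data.Vec.Functional.Properties using (updateAt-updates; updateAt-minimal)
open import Data.Vec.Properties using (≡-dec)
import Data.Bool.Properties as Bool
open import Function.Base using (_∘_; const)
open import Relation.Binary.Definitions using (tri<; tri≈; tri>)
open import Relation.Binary.PropositionalEquality.Core using (_≡_; _≢_; refl; sym; trans; cong; cong₂; subst)
open import Relation.Binary.PropositionalEquality.Properties using (module ≡-Reasoning)
open import Relation.Nullary.Decidable using (Dec; yes; no; does; dec-true; dec-false; ¬?; _×-dec_; decidable-stable)
open import Relation.Nullary.Negation using (¬_; contradiction)

open import Algebra.Properties.Semiring.Sum +-*-semiring using (sum; sum-cong-≗; sum-replicate-zero; sum-remove; ∑-distrib-+; ∑-comm; *-distribˡ-sum)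
open ≡-Reasoning

private
  variable
    m n : ℕ

-- Finite sums

sum-zero : (f : Vector ℤ n) → (∀ i → f i ≡ 0ℤ) → sum f ≡ 0ℤ
sum-zero {n} f f≡0 = trans (sum-cong-≗ f≡0) (sum-replicate-zero n)

sum-single : (i : Fin n) (f : Vector ℤ n) → (∀ k → k ≢ i → f k ≡ 0ℤ) → sum f ≡ f i
sum-single {suc n} i f f≡0 = begin
  sum f                          ≡⟨ sum-remove {i = i} f ⟩
  f i + sum (f ∘ punchIn i)      ≡⟨ cong (f i +_) (sum-zero (f ∘ punchIn i) (λ k → f≡0 _ (punchInᵢ≢i i k))) ⟩
  f i + 0ℤ                       ≡⟨ +-identityʳ _ ⟩
  f i                            ∎

sum-linear : (c : ℤ) (f g h : Vector ℤ n) → (∀ j → h j ≡ c * f j + g j) → sum h ≡ c * sum f + sum g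
sum-linear c f g h eq = begin
  sum h                                ≡⟨ sum-cong-≗ eq ⟩
  sum (λ j → c * f j + g j)            ≡⟨ ∑-distrib-+ (λ j → c * f j) g ⟩
  sum (λ j → c * f j) + sum g          ≡⟨ cong (_+ sum g) (*-distribˡ-sum c f) ⟨
  c * sum f + sum g                    ∎

-- Determinants

minor : Matrix (suc m) → Fin (suc m) → Matrix m
minor A j i k = A (suc i) (punchIn j k)

det-cong : {A B : Matrix m} → (∀ i j → A i j ≡ B i j) → det A ≡ det B
det-cong {zero}  eq = refl
det-cong {suc m} eq = sum-cong-≗ λ j →
  cong₂ _*_ (cong (-1ℤ ^ toℕ j *_) (eq zero j)) (det-cong λ i k → eq (suc i) (punchIn j k))

-- If `i` is the top row, the minors of `A`, `B` and `C` agree and the expansion is linear in the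
-- top entries; otherwise the top entries agree and every minor falls under the induction. Scaling
-- and adding are treated at once, and the matrices are related entry by entry so that the
-- hypotheses pass to minors.
det-linear : (i : Fin m) (c : ℤ) {A B C : Matrix m} →
             (∀ k → k ≢ i → ∀ j → A k j ≡ C k j) →
             (∀ k → k ≢ i → ∀ j → B k j ≡ C k j) →
             (∀ j → C i j ≡ c * A i j + B i j) →
             det C ≡ c * det A + det B
det-linear {suc m} zero c {A} {B} {C} A≗C B≗C C₀ = sum-linear c _ _ _ λ j → begin
  -1ℤ ^ toℕ j * C zero j * det (minor C j)
    ≡⟨ cong (λ x → -1ℤ ^ toℕ j * x * det (minor C j)) (C₀ j) ⟩
  -1ℤ ^ toℕ j * (c * A zero j + B zero j) * det (minor C j)
    ≡⟨ distribute (-1ℤ ^ toℕ j) c (A zero j) (B zero j) (det (minor C j)) ⟩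
  c * (-1ℤ ^ toℕ j * A zero j * det (minor C j)) + -1ℤ ^ toℕ j * B zero j * det (minor C j)
    ≡⟨ cong₂ (λ x y → c * (-1ℤ ^ toℕ j * A zero j * x) + -1ℤ ^ toℕ j * B zero j * y)
         (det-cong λ i k → A≗C (suc i) (λ ()) (punchIn j k))
         (det-cong λ i k → B≗C (suc i) (λ ()) (punchIn j k)) ⟨
  c * (-1ℤ ^ toℕ j * A zero j * det (minor A j)) + -1ℤ ^ toℕ j * B zero j * det (minor B j) ∎
  where
  distribute : ∀ s c a b d → s * (c * a + b) * d ≡ c * (s * a * d) + s * b * d
  distribute = solve-∀
det-linear {suc m} (suc i) c {A} {B} {C} A≗C B≗C Cᵢ = sum-linear c _ _ _ λ j → begin
  -1ℤ ^ toℕ j * C zero j * det (minor C j)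
    ≡⟨ cong (-1ℤ ^ toℕ j * C zero j *_)
         (det-linear i c (λ k k≢i l → A≗C (suc k) (k≢i ∘ suc-injective) (punchIn j l))
                         (λ k k≢i l → B≗C (suc k) (k≢i ∘ suc-injective) (punchIn j l))
                         (λ l → Cᵢ (punchIn j l))) ⟩
  -1ℤ ^ toℕ j * C zero j * (c * det (minor A j) + det (minor B j))
    ≡⟨ distribute (-1ℤ ^ toℕ j) c (C zero j) (det (minor A j)) (det (minor B j)) ⟩
  c * (-1ℤ ^ toℕ j * C zero j * det (minor A j)) + -1ℤ ^ toℕ j * C zero j * det (minor B j)
    ≡⟨ cong₂ (λ x y → c * (-1ℤ ^ toℕ j * x * det (minor A j)) + -1ℤ ^ toℕ j * y * det (minor B j))
         (A≗C zero (λ ()) j) (B≗C zero (λ ()) j) ⟨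
  c * (-1ℤ ^ toℕ j * A zero j * det (minor A j)) + -1ℤ ^ toℕ j * B zero j * det (minor B j) ∎
  where
  distribute : ∀ s c x a b → s * x * (c * a + b) ≡ c * (s * x * a) + s * x * b
  distribute = solve-∀

-- Swapping, repeating and scaling rows

swapTopRows : Matrix (suc (suc m)) → Matrix (suc (suc m))
swapTopRows A zero          = A (suc zero)
swapTopRows A (suc zero)    = A zero
swapTopRows A (suc (suc i)) = A (suc (suc i))

-- Deleting the smaller of two columns lowers the index of the larger by one, while deleting the
-- larger leaves the smaller in place. So the two exponents `j + punchOut p` and `l + punchOut q`
-- differ by exactly one.
punchOut-sign : {j l : Fin (suc n)} (p : j ≢ l) (q : l ≢ j) →
                -1ℤ ^ toℕ j * -1ℤ ^ toℕ (punchOut p) ≡ -1ℤ * (-1ℤ ^ toℕ l * -1ℤ ^ toℕ (punchOut q))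
punchOut-sign {j = zero}  {zero}  p q = contradiction refl p
punchOut-sign {suc n} {zero} {suc l} p q = identity (-1ℤ ^ toℕ l)
  where
  identity : ∀ x → 1ℤ * x ≡ -1ℤ * (-1ℤ * x * 1ℤ)
  identity = solve-∀
punchOut-sign {suc n} {suc j} {zero} p q = identity (-1ℤ ^ toℕ j)
  where
  identity : ∀ x → -1ℤ * x * 1ℤ ≡ -1ℤ * (1ℤ * x)
  identity = solve-∀
punchOut-sign {suc n} {suc j} {suc l} p q = begin
  -1ℤ * x * (-1ℤ * y)                 ≡⟨ cancel x y ⟩
  x * y                               ≡⟨ punchOut-sign (p ∘ cong suc) (q ∘ cong suc) ⟩
  -1ℤ * (z * w)                       ≡⟨ cong (-1ℤ *_) (cancel z w) ⟨
  -1ℤ * (-1ℤ * z * (-1ℤ * w))         ∎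
  where
  x = -1ℤ ^ toℕ j
  y = -1ℤ ^ toℕ (punchOut (p ∘ cong suc))
  z = -1ℤ ^ toℕ l
  w = -1ℤ ^ toℕ (punchOut (q ∘ cong suc))
  cancel : ∀ a b → -1ℤ * a * (-1ℤ * b) ≡ a * b
  cancel = solve-∀

-- Both sides list in increasing order the columns other than `j` and `l`, so the minor with two
-- columns deleted does not depend on the order of deletion.
punchIn-punchOut-comm : {j l : Fin (suc (suc n))} (p : j ≢ l) (q : l ≢ j) (k : Fin n) →
                        punchIn j (punchIn (punchOut p) k) ≡ punchIn l (punchIn (punchOut q) k)
punchIn-punchOut-comm {j = zero}  {zero}  p q k       = contradiction refl p
punchIn-punchOut-comm {j = zero}  {suc l} p q k       = refl
punchIn-punchOut-comm {j = suc j} {zero}  p q k       = refl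
punchIn-punchOut-comm {j = suc j} {suc l} p q zero    = refl
punchIn-punchOut-comm {j = suc j} {suc l} p q (suc k) =
  cong suc (punchIn-punchOut-comm (p ∘ cong suc) (q ∘ cong suc) k)

-- The contribution to det A of choosing column j in row 0 and column l in row 1.
pairTerm : (A : Matrix (suc (suc m))) (j l : Fin (suc (suc m))) → Dec (j ≡ l) → ℤ
pairTerm A j l (yes _)  = 0ℤ
pairTerm A j l (no j≢l) =
  -1ℤ ^ toℕ j * A zero j *
  (-1ℤ ^ toℕ (punchOut j≢l) * A (suc zero) l * det (minor (minor A j) (punchOut j≢l)))

pairTerm-diagonal : (A : Matrix (suc (suc m))) (j : Fin (suc (suc m))) (d : Dec (j ≡ j)) → pairTerm A j j d ≡ 0ℤ
pairTerm-diagonal A j (yes _)  = refl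
pairTerm-diagonal A j (no j≢j) = contradiction refl j≢j

-- `punchOut` inverts `punchIn j` whichever proof of inequality it receives, so the column deleted
-- second is `k` itself.
pairTerm-punchIn : (A : Matrix (suc (suc m))) (j : Fin (suc (suc m))) (k : Fin (suc m)) (d : Dec (j ≡ punchIn j k)) →
                   pairTerm A j (punchIn j k) d ≡
                   -1ℤ ^ toℕ j * A zero j * (-1ℤ ^ toℕ k * minor A j zero k * det (minor (minor A j) k))
pairTerm-punchIn A j k (yes j≡) = contradiction (sym j≡) (punchInᵢ≢i j k)
pairTerm-punchIn A j k (no j≢)  =
  cong (λ k′ → -1ℤ ^ toℕ j * A zero j * (-1ℤ ^ toℕ k′ * minor A j zero k * det (minor (minor A j) k′)))
       (trans (punchOut-cong j refl) (punchOut-punchIn j))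

pairTerm-swap : (A : Matrix (suc (suc m))) (j l : Fin (suc (suc m))) (d : Dec (j ≡ l)) (e : Dec (l ≡ j)) →
                pairTerm A j l d ≡ -1ℤ * pairTerm (swapTopRows A) l j e
pairTerm-swap A j l (yes _)   (yes _)   = refl
pairTerm-swap A j l (yes j≡l) (no l≢j)  = contradiction (sym j≡l) l≢j
pairTerm-swap A j l (no j≢l)  (yes l≡j) = contradiction (sym l≡j) j≢l
pairTerm-swap A j l (no j≢l)  (no l≢j)  = begin
  sj * u * (sk * v * D)                 ≡⟨ gather sj u sk v D ⟩
  sj * sk * (u * v * D)                 ≡⟨ cong₂ (λ s d → s * (u * v * d)) (punchOut-sign j≢l l≢j)
                                             (det-cong λ i q → cong (A (suc (suc i))) (punchIn-punchOut-comm j≢l l≢j q)) ⟩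
  -1ℤ * (sl * sk′) * (u * v * D′)       ≡⟨ spread sl v sk′ u D′ ⟩
  -1ℤ * (sl * v * (sk′ * u * D′))       ∎
  where
  sj  = -1ℤ ^ toℕ j
  sl  = -1ℤ ^ toℕ l
  sk  = -1ℤ ^ toℕ (punchOut j≢l)
  sk′ = -1ℤ ^ toℕ (punchOut l≢j)
  u   = A zero j
  v   = A (suc zero) l
  D   = det (minor (minor A j) (punchOut j≢l))
  D′  = det (minor (minor (swapTopRows A) l) (punchOut l≢j))
  gather : ∀ a b c d e → a * b * (c * d * e) ≡ a * c * (b * d * e)
  gather = solve-∀
  spread : ∀ a b c d e → -1ℤ * (a * c) * (d * b * e) ≡ -1ℤ * (a * b * (c * d * e))
  spread = solve-∀

-- Two successive expansions sum over `j` and then over the remaining columns. Adding the zero term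
-- `l = j` turns this into a sum over a full square of pairs, in which `j` and `l` can trade places.
det-pairTerm : (A : Matrix (suc (suc m))) → det A ≡ sum (λ j → sum (λ l → pairTerm A j l (j ≟ l)))
det-pairTerm A = sum-cong-≗ λ j → begin
  -1ℤ ^ toℕ j * A zero j * det (minor A j)
    ≡⟨ *-distribˡ-sum (-1ℤ ^ toℕ j * A zero j) (λ k → -1ℤ ^ toℕ k * minor A j zero k * det (minor (minor A j) k)) ⟩
  sum (λ k → -1ℤ ^ toℕ j * A zero j * (-1ℤ ^ toℕ k * minor A j zero k * det (minor (minor A j) k)))
    ≡⟨ sum-cong-≗ (λ k → pairTerm-punchIn A j k (j ≟ punchIn j k)) ⟨
  sum (λ k → pairTerm A j (punchIn j k) (j ≟ punchIn j k))
    ≡⟨ +-identityˡ _ ⟨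
  0ℤ + sum (λ k → pairTerm A j (punchIn j k) (j ≟ punchIn j k))
    ≡⟨ cong (_+ sum (λ k → pairTerm A j (punchIn j k) (j ≟ punchIn j k))) (pairTerm-diagonal A j (j ≟ j)) ⟨
  pairTerm A j j (j ≟ j) + sum (λ k → pairTerm A j (punchIn j k) (j ≟ punchIn j k))
    ≡⟨ sum-remove {i = j} (λ l → pairTerm A j l (j ≟ l)) ⟨
  sum (λ l → pairTerm A j l (j ≟ l)) ∎

-- Exchanging the two summations matches the pair `(j , l)` of `A` with the pair `(l , j)` of the
-- swapped matrix, and these terms have opposite signs.
det-swapTopRows : (A : Matrix (suc (suc m))) → det A ≡ -1ℤ * det (swapTopRows A)
det-swapTopRows A = begin
  det A                                           ≡⟨ det-pairTerm A ⟩
  sum (λ j → sum (λ l → pairTerm A j l (j ≟ l)))  ≡⟨ sum-cong-≗ (λ j → trans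
                                                       (sum-cong-≗ (λ l → pairTerm-swap A j l (j ≟ l) (l ≟ j)))
                                                       (sym (*-distribˡ-sum -1ℤ (λ l → T l j)))) ⟩
  sum (λ j → -1ℤ * sum (λ l → T l j))             ≡⟨ *-distribˡ-sum -1ℤ (λ j → sum (λ l → T l j)) ⟨
  -1ℤ * sum (λ j → sum (λ l → T l j))             ≡⟨ cong (-1ℤ *_) (∑-comm T) ⟨
  -1ℤ * sum (λ l → sum (λ j → T l j))             ≡⟨ cong (-1ℤ *_) (det-pairTerm (swapTopRows A)) ⟨
  -1ℤ * det (swapTopRows A)                       ∎
  where
  T = λ l j → pairTerm (swapTopRows A) l j (l ≟ j)

x≡-x⇒x≡0 : ∀ x → x ≡ -1ℤ * x → x ≡ 0ℤ
x≡-x⇒x≡0 +0       eq = refl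
-- For non-zero `x`, `-1ℤ * x` computes to a number of the other sign.
x≡-x⇒x≡0 +[1+ x ] ()
x≡-x⇒x≡0 -[1+ x ] ()

det-zeroMinors : (A : Matrix (suc m)) → (∀ j → det (minor A j) ≡ 0ℤ) → det A ≡ 0ℤ
det-zeroMinors A eq = sum-zero _ λ j →
  trans (cong (-1ℤ ^ toℕ j * A zero j *_) (eq j)) (*-zeroʳ (-1ℤ ^ toℕ j * A zero j))

-- When neither equal row is the top one, both survive in every minor of the expansion and induction
-- applies. The remaining case is `det-topRowRepeated`.
det-equalRows : (A : Matrix m) {i k : Fin m} → i ≢ k → (∀ j → A i j ≡ A k j) → det A ≡ 0ℤ
det-topRowRepeated : (A : Matrix (suc m)) (k : Fin m) → (∀ j → A zero j ≡ A (suc k) j) → det A ≡ 0ℤ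

det-equalRows A {zero}  {zero}  i≢k eq = contradiction refl i≢k
det-equalRows A {zero}  {suc k} i≢k eq = det-topRowRepeated A k eq
det-equalRows A {suc i} {zero}  i≢k eq = det-topRowRepeated A i (sym ∘ eq)
det-equalRows A {suc i} {suc k} i≢k eq = det-zeroMinors A λ j →
  det-equalRows (minor A j) (i≢k ∘ cong suc) (λ l → eq (punchIn j l))

-- The top two rows are equal, so the swap fixes the matrix and the determinant is its own negative.
det-topRowRepeated A zero eq = x≡-x⇒x≡0 (det A) (begin
  det A                      ≡⟨ det-swapTopRows A ⟩
  -1ℤ * det (swapTopRows A)  ≡⟨ cong (-1ℤ *_) (det-cong swap≗A) ⟩
  -1ℤ * det A                ∎)
  where
  swap≗A : ∀ i j → swapTopRows A i j ≡ A i j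
  swap≗A zero          j = sym (eq j)
  swap≗A (suc zero)    j = eq j
  swap≗A (suc (suc i)) j = refl
-- The swap moves the repeated row to second place, so it becomes the top row of each minor, with
-- its copy below it.
det-topRowRepeated A (suc k) eq = begin
  det A                      ≡⟨ det-swapTopRows A ⟩
  -1ℤ * det (swapTopRows A)  ≡⟨ cong (-1ℤ *_) (det-zeroMinors (swapTopRows A) λ j →
                                  det-topRowRepeated (minor (swapTopRows A) j) k (λ l → eq (punchIn j l))) ⟩
  -1ℤ * 0ℤ                   ≡⟨⟩
  0ℤ                         ∎

-- Rows are indexed by positions in a list so that the scalar produced is literally the product that
-- defines `φ`.
det-scaleRows : {X : Set} (f : X → ℤ) (xs : List X) (A : Matrix (length xs)) →
                det (λ i j → f (lookup xs i) * A i j) ≡ foldr _*_ 1ℤ (map f xs) * det A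
det-scaleRows f []       A = refl
det-scaleRows f (x ∷ xs) A = begin
  sum (λ j → -1ℤ ^ toℕ j * (f x * A zero j) * det (λ i k → f (lookup xs i) * minor A j i k))
    ≡⟨ sum-cong-≗ (λ j → trans
         (cong (-1ℤ ^ toℕ j * (f x * A zero j) *_) (det-scaleRows f xs (minor A j)))
         (regroup (-1ℤ ^ toℕ j) (f x) (A zero j) P (det (minor A j)))) ⟩
  sum (λ j → f x * P * (-1ℤ ^ toℕ j * A zero j * det (minor A j)))
    ≡⟨ *-distribˡ-sum (f x * P) (λ j → -1ℤ ^ toℕ j * A zero j * det (minor A j)) ⟨
  f x * P * det A ∎
  where
  P = foldr _*_ 1ℤ (map f xs)
  regroup : ∀ s a b p d → s * (a * b) * (p * d) ≡ a * p * (s * b * d)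
  regroup = solve-∀

-- Replacing a row, and products with a unitriangular matrix

replaceRow : Matrix m → Fin m → Vector ℤ m → Matrix m
replaceRow A i r = updateAt A i (const r)

replaceRow-at : (A : Matrix m) (i : Fin m) (r : Vector ℤ m) → ∀ j → replaceRow A i r i j ≡ r j
replaceRow-at A i r j = cong (λ row → row j) (updateAt-updates i A)

replaceRow-off : (A : Matrix m) (i : Fin m) (r : Vector ℤ m) {k : Fin m} → k ≢ i → ∀ j → replaceRow A i r k j ≡ A k j
replaceRow-off A i r k≢i j = cong (λ row → row j) (updateAt-minimal _ i A k≢i)

replaceRow-unique : (A B : Matrix m) (i : Fin m) (r : Vector ℤ m) →
                    (∀ j → B i j ≡ r j) → (∀ k → k ≢ i → ∀ j → B k j ≡ A k j) →
                    ∀ k j → B k j ≡ replaceRow A i r k j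
replaceRow-unique A B i r at off k j with k ≟ i
... | yes refl = trans (at j) (sym (replaceRow-at A i r j))
... | no k≢i   = trans (off k k≢i j) (sym (replaceRow-off A i r k≢i j))

det-replaceRow-linear : (A : Matrix m) (i : Fin m) (c : ℤ) (u v : Vector ℤ m) →
                        det (replaceRow A i (λ j → c * u j + v j)) ≡
                        c * det (replaceRow A i u) + det (replaceRow A i v)
det-replaceRow-linear A i c u v = det-linear i c
  (λ k k≢i j → trans (replaceRow-off A i u k≢i j) (sym (replaceRow-off A i w k≢i j)))
  (λ k k≢i j → trans (replaceRow-off A i v k≢i j) (sym (replaceRow-off A i w k≢i j)))
  (λ j → trans (replaceRow-at A i w j)
    (sym (cong₂ (λ x y → c * x + y) (replaceRow-at A i u j) (replaceRow-at A i v j))))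
  where
  w = λ j → c * u j + v j

-- The zero row computes to `-1ℤ` times itself plus itself, so linearity gives `d ≡ -1ℤ * d + d`.
det-replaceRow-zero : (A : Matrix m) (i : Fin m) → det (replaceRow A i (const 0ℤ)) ≡ 0ℤ
det-replaceRow-zero A i = begin
  d                                             ≡⟨ det-replaceRow-linear A i -1ℤ (const 0ℤ) (const 0ℤ) ⟩
  -1ℤ * d + d                                   ≡⟨ cancel d ⟩
  0ℤ                                            ∎
  where
  d = det (replaceRow A i (const 0ℤ))
  cancel : ∀ x → -1ℤ * x + x ≡ 0ℤ
  cancel = solve-∀

det-replaceRow-sum : (A : Matrix m) (i : Fin m) (c : Vector ℤ n) (R : Fin n → Vector ℤ m) →
                     det (replaceRow A i (λ j → sum (λ k → c k * R k j))) ≡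
                     sum (λ k → c k * det (replaceRow A i (R k)))
det-replaceRow-sum {n = zero}  A i c R = det-replaceRow-zero A i
det-replaceRow-sum {n = suc n} A i c R = trans
  (det-replaceRow-linear A i (c zero) (R zero) _)
  (cong (c zero * det (replaceRow A i (R zero)) +_) (det-replaceRow-sum A i (c ∘ suc) (R ∘ suc)))

infixl 7 _⊗_
_⊗_ : Matrix m → Matrix m → Matrix m
(M ⊗ A) i j = sum (λ k → M i k * A k j)

-- Rows of A are replaced by rows of M ⊗ A in decreasing order of their key, so
-- that every row still needed for a replacement is the original one.
module Unitriangular
  (key : Fin m → Fin n) (key-injective : ∀ {i j} → key i ≡ key j → i ≡ j)
  (M A : Matrix m)
  (diagonal : ∀ i → M i i ≡ 1ℤ)
  (triangular : ∀ {i j} → key i <ᶠ key j → M i j ≡ 0ℤ)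
  where

  hybrid : ℕ → Matrix m
  hybrid t i = if does (t ℕ.≤? toℕ (key i)) then (M ⊗ A) i else A i

  hybrid-new : ∀ {t i} → t ℕ.≤ toℕ (key i) → hybrid t i ≡ (M ⊗ A) i
  hybrid-new {t} {i} t≤ = cong (if_then (M ⊗ A) i else A i) (dec-true (t ℕ.≤? toℕ (key i)) t≤)

  hybrid-old : ∀ {t i} → toℕ (key i) ℕ.< t → hybrid t i ≡ A i
  hybrid-old {t} {i} <t = cong (if_then (M ⊗ A) i else A i) (dec-false (t ℕ.≤? toℕ (key i)) (ℕ.<⇒≱ <t))

  hybrid-unchanged : ∀ {t i} → toℕ (key i) ≢ t → hybrid t i ≡ hybrid (suc t) i
  hybrid-unchanged {t} {i} ≢t with ℕ.<-cmp (toℕ (key i)) t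
  ... | tri< <t _ _ = trans (hybrid-old <t) (sym (hybrid-old (ℕ.m<n⇒m<1+n <t)))
  ... | tri≈ _ ≡t _ = contradiction ≡t ≢t
  ... | tri> _ _ >t = trans (hybrid-new (ℕ.<⇒≤ >t)) (sym (hybrid-new >t))

  -- Row `i` of the product is a combination of the rows `A k`, so linearity splits the determinant.
  -- If `k` has a larger key, the coefficient vanishes; if it has a smaller key, row `k` of `H` is
  -- still `A k` and two rows coincide. Only `k = i` remains, with coefficient 1, and it restores
  -- `H`.
  det-hybrid-row : ∀ i → det (hybrid (toℕ (key i))) ≡ det (hybrid (suc (toℕ (key i))))
  det-hybrid-row i = begin
    det (hybrid t)                                ≡⟨ det-cong (replaceRow-unique H (hybrid t) i ((M ⊗ A) i)
                                                       (λ j → cong (λ r → r j) (hybrid-new ℕ.≤-refl))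
                                                       (λ k k≢i j → cong (λ r → r j)
                                                         (hybrid-unchanged (k≢i ∘ key-injective ∘ toℕ-injective)))) ⟩
    det (replaceRow H i ((M ⊗ A) i))              ≡⟨ det-replaceRow-sum H i (M i) A ⟩
    sum (λ k → M i k * det (replaceRow H i (A k)))
                                                  ≡⟨ sum-single i _ off-diagonal ⟩
    M i i * det (replaceRow H i (A i))            ≡⟨ cong (_* det (replaceRow H i (A i))) (diagonal i) ⟩
    1ℤ * det (replaceRow H i (A i))               ≡⟨ *-identityˡ _ ⟩
    det (replaceRow H i (A i))                    ≡⟨ det-cong (replaceRow-unique H H i (A i)
                                                       (λ j → cong (λ r → r j) (hybrid-old ℕ.≤-refl))
                                                       (λ k _ j → refl)) ⟨
    det H                                         ∎
    where
    t = toℕ (key i)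
    H = hybrid (suc t)
    off-diagonal : ∀ k → k ≢ i → M i k * det (replaceRow H i (A k)) ≡ 0ℤ
    off-diagonal k k≢i with <-cmp (key k) (key i)
    ... | tri> _ _ i<k = cong (_* det (replaceRow H i (A k))) (triangular i<k)
    ... | tri≈ _ eq _  = contradiction (key-injective eq) k≢i
    ... | tri< k<i _ _ = trans (cong (M i k *_) (det-equalRows (replaceRow H i (A k)) k≢i λ j → begin
      replaceRow H i (A k) k j   ≡⟨ replaceRow-off H i (A k) k≢i j ⟩
      H k j                      ≡⟨ cong (λ r → r j) (hybrid-old (ℕ.m<n⇒m<1+n k<i)) ⟩
      A k j                      ≡⟨ replaceRow-at H i (A k) j ⟨
      replaceRow H i (A k) i j   ∎)) (*-zeroʳ (M i k))

  -- Keys are distinct, so at most one row changes at level `t`; at a level that is no row's key the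
  -- two hybrids coincide.
  det-hybrid-step : ∀ t → det (hybrid t) ≡ det (hybrid (suc t))
  det-hybrid-step t with any? (λ i → toℕ (key i) ℕ.≟ t)
  ... | yes (i , refl) = det-hybrid-row i
  ... | no ∄i          = det-cong λ i j → cong (λ r → r j) (hybrid-unchanged (λ eq → ∄i (i , eq)))

  det-hybrid : ∀ t → det (hybrid 0) ≡ det (hybrid t)
  det-hybrid zero    = refl
  det-hybrid (suc t) = trans (det-hybrid t) (det-hybrid-step t)

  det-⊗ : det (M ⊗ A) ≡ det A
  -- `hybrid 0` computes to the product, and level `n` lies above every key, which leaves `A`.
  det-⊗ = trans (det-hybrid n) (det-cong λ i j → cong (λ r → r j) (hybrid-old (toℕ<n (key i))))

-- A rank such as cardinality has ties, whereas rows must be replaced one at a time. `combine`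
-- orders the rows lexicographically by rank and then by index, which makes the key injective.
det-unitriangular-⊗ : (rank : Fin m → Fin n) (M A : Matrix m) →
                      (∀ i → M i i ≡ 1ℤ) →
                      (∀ {i j} → i ≢ j → ¬ (rank j <ᶠ rank i) → M i j ≡ 0ℤ) →
                      det (M ⊗ A) ≡ det A
det-unitriangular-⊗ {m} rank M A diagonal triangular =
  Unitriangular.det-⊗ key (λ {i} {j} → combine-injectiveʳ (rank i) i (rank j) j) M A diagonal λ {i} {j} i<j →
    triangular (λ { refl → ℕ.<-irrefl refl i<j })
               (λ rj<ri → ℕ.<-asym i<j (combine-monoˡ-< j i rj<ri))
  where
  key = λ i → combine (rank i) i

-- Indicators

-- The entries of `connectionMatrix` are values of `χ` by computation.
χ : {P : Set} → Dec P → ℤ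
χ d = if does d then 1ℤ else 0ℤ

χ-yes : {P : Set} (d : Dec P) → P → χ d ≡ 1ℤ
χ-yes (yes _) p = refl
χ-yes (no ¬p) p = contradiction p ¬p

χ-no : {P : Set} (d : Dec P) → ¬ P → χ d ≡ 0ℤ
χ-no (yes p) ¬p = contradiction p ¬p
χ-no (no _)  ¬p = refl

χ-cong : {P Q : Set} (d : Dec P) (e : Dec Q) → (P → Q) → (Q → P) → χ d ≡ χ e
χ-cong (yes p) e P→Q Q→P = sym (χ-yes e (P→Q p))
χ-cong (no ¬p) e P→Q Q→P = sym (χ-no e (¬p ∘ Q→P))

-- Determinant of a unitriangular matrix

identityMatrix : Matrix m
identityMatrix i j = χ (i ≟ j)

det-identity : ∀ m → det (identityMatrix {m}) ≡ 1ℤ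
det-identity zero    = refl
det-identity (suc m) = begin
  det (identityMatrix {suc m})                  ≡⟨ sum-single zero _ off-diagonal ⟩
  1ℤ * 1ℤ * det (identityMatrix {m})            ≡⟨ *-identityˡ _ ⟩
  det (identityMatrix {m})                      ≡⟨ det-identity m ⟩
  1ℤ                                            ∎
  where
  off-diagonal : ∀ k → k ≢ zero → -1ℤ ^ toℕ k * identityMatrix {suc m} zero k * det (minor identityMatrix k) ≡ 0ℤ
  off-diagonal zero    k≢0 = contradiction refl k≢0
  off-diagonal (suc k) k≢0 = cong (_* det (minor (identityMatrix {suc m}) (suc k))) (*-zeroʳ (-1ℤ ^ toℕ (suc k)))

⊗-identityʳ : (M : Matrix m) → ∀ i j → (M ⊗ identityMatrix) i j ≡ M i j
⊗-identityʳ M i j = begin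
  sum (λ k → M i k * χ (k ≟ j))    ≡⟨ sum-single j _ (λ k k≢j → trans (cong (M i k *_) (χ-no (k ≟ j) k≢j)) (*-zeroʳ (M i k))) ⟩
  M i j * χ (j ≟ j)                ≡⟨ cong (M i j *_) (χ-yes (j ≟ j) refl) ⟩
  M i j * 1ℤ                       ≡⟨ *-identityʳ _ ⟩
  M i j                            ∎

-- Multiplying the identity by `M` returns `M` and, by the product lemma, leaves the determinant of
-- the identity unchanged.
det-unitriangular : (rank : Fin m → Fin n) (M : Matrix m) →
                    (∀ i → M i i ≡ 1ℤ) →
                    (∀ {i j} → i ≢ j → ¬ (rank j <ᶠ rank i) → M i j ≡ 0ℤ) →
                    det M ≡ 1ℤ
det-unitriangular {m} rank M diagonal triangular = begin
  det M                       ≡⟨ det-cong (⊗-identityʳ M) ⟨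
  det (M ⊗ identityMatrix)    ≡⟨ det-unitriangular-⊗ rank M identityMatrix diagonal triangular ⟩
  det (identityMatrix {m})    ≡⟨ det-identity m ⟩
  1ℤ                          ∎

-- Sums over all subsets

-- Splitting on the first label provides the induction of `sum-signs`. Sums over simplices are
-- brought into this form by a membership indicator.
sumSubsets : (Subset n → ℤ) → ℤ
sumSubsets {zero}  g = g []
sumSubsets {suc n} g = sumSubsets (λ z → g (inside ∷ z)) + sumSubsets (λ z → g (outside ∷ z))

sumSubsets-cong : {f g : Subset n → ℤ} → (∀ z → f z ≡ g z) → sumSubsets f ≡ sumSubsets g
sumSubsets-cong {zero}  eq = eq []
sumSubsets-cong {suc n} eq =
  cong₂ _+_ (sumSubsets-cong (λ z → eq (inside ∷ z))) (sumSubsets-cong (λ z → eq (outside ∷ z)))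

sumSubsets-linear : (c : ℤ) (f g : Subset n → ℤ) →
                    sumSubsets (λ z → c * f z + g z) ≡ c * sumSubsets f + sumSubsets g
sumSubsets-linear {zero}  c f g = refl
sumSubsets-linear {suc n} c f g = trans
  (cong₂ _+_ (sumSubsets-linear c (λ z → f (inside ∷ z)) (λ z → g (inside ∷ z)))
             (sumSubsets-linear c (λ z → f (outside ∷ z)) (λ z → g (outside ∷ z))))
  (regroup c _ _ _ _)
  where
  regroup : ∀ c a b d e → c * a + b + (c * d + e) ≡ c * (a + d) + (b + e)
  regroup = solve-∀

sumSubsets-zero : (f : Subset n → ℤ) → (∀ z → f z ≡ 0ℤ) → sumSubsets f ≡ 0ℤ
sumSubsets-zero {zero}  f eq = eq []
sumSubsets-zero {suc n} f eq =
  cong₂ _+_ (sumSubsets-zero _ (λ z → eq (inside ∷ z))) (sumSubsets-zero _ (λ z → eq (outside ∷ z)))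

_≟ˢ_ : (x y : Subset n) → Dec (x ≡ y)
_≟ˢ_ = ≡-dec Bool._≟_

infix 4 _∈ˡ?_
_∈ˡ?_ : (z : Subset n) (xs : List (Subset n)) → Dec (z ∈ˡ xs)
_∈ˡ?_ = DecMembership._∈?_ _≟ˢ_

sumSubsets-single : (x : Subset n) (g : Subset n → ℤ) → (∀ z → z ≢ x → g z ≡ 0ℤ) → sumSubsets g ≡ g x
sumSubsets-single []            g eq = refl
sumSubsets-single (inside ∷ x)  g eq = trans
  (cong₂ _+_ (sumSubsets-single x (λ z → g (inside ∷ z)) (λ z z≢x → eq _ (λ { refl → z≢x refl })))
             (sumSubsets-zero _ (λ z → eq (outside ∷ z) (λ ()))))
  (+-identityʳ _)
sumSubsets-single (outside ∷ x) g eq = trans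
  (cong₂ _+_ (sumSubsets-zero _ (λ z → eq (inside ∷ z) (λ ())))
             (sumSubsets-single x (λ z → g (outside ∷ z)) (λ z z≢x → eq _ (λ { refl → z≢x refl }))))
  (+-identityˡ _)

sumSubsets-χ≡ : (x : Subset n) (g : Subset n → ℤ) → sumSubsets (λ z → χ (z ≟ˢ x) * g z) ≡ g x
sumSubsets-χ≡ x g = begin
  sumSubsets (λ z → χ (z ≟ˢ x) * g z)   ≡⟨ sumSubsets-single x _ (λ z z≢x → cong (_* g z) (χ-no (z ≟ˢ x) z≢x)) ⟩
  χ (x ≟ˢ x) * g x                      ≡⟨ cong (_* g x) (χ-yes (x ≟ˢ x) refl) ⟩
  1ℤ * g x                              ≡⟨ *-identityˡ _ ⟩
  g x                                   ∎

-- Since `x` does not recur in `xs`, the two indicators on the right are never both 1.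
χ-∈-∷ : {x : Subset n} {xs : List (Subset n)} → All (x ≢_) xs → ∀ z →
        χ (z ∈ˡ? x ∷ xs) ≡ χ (z ≟ˢ x) + χ (z ∈ˡ? xs)
χ-∈-∷ {x = x} {xs} x∉xs z with z ≟ˢ x
... | yes refl = sym (cong (1ℤ +_) (χ-no (x ∈ˡ? xs) (λ x∈xs → All.lookup x∉xs x∈xs refl)))
... | no z≢x   = sym (+-identityˡ _)

-- Removes the arbitrary order of the list. Uniqueness is essential: a repeated entry would count
-- several times on the left but once on the right.
sum-lookup : {xs : List (Subset n)} → Unique xs → (g : Subset n → ℤ) →
             sum (λ i → g (lookup xs i)) ≡ sumSubsets (λ z → χ (z ∈ˡ? xs) * g z)
sum-lookup []                        g = sym (sumSubsets-zero (λ z → 0ℤ * g z) (λ z → refl))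
sum-lookup {xs = x ∷ xs} (x∉xs ∷ un) g = begin
  g x + sum (λ i → g (lookup xs i))
    ≡⟨ cong₂ _+_ (sumSubsets-χ≡ x g) (sym (sum-lookup un g)) ⟨
  sumSubsets (λ z → χ (z ≟ˢ x) * g z) + sumSubsets (λ z → χ (z ∈ˡ? xs) * g z)
    -- The factor `1ℤ` brings the sum into the shape of `sumSubsets-linear`.
    ≡⟨ cong (_+ sumSubsets (λ z → χ (z ∈ˡ? xs) * g z)) (*-identityˡ (sumSubsets (λ z → χ (z ≟ˢ x) * g z))) ⟨
  1ℤ * sumSubsets (λ z → χ (z ≟ˢ x) * g z) + sumSubsets (λ z → χ (z ∈ˡ? xs) * g z)
    ≡⟨ sumSubsets-linear 1ℤ (λ z → χ (z ≟ˢ x) * g z) (λ z → χ (z ∈ˡ? xs) * g z) ⟨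
  sumSubsets (λ z → 1ℤ * (χ (z ≟ˢ x) * g z) + χ (z ∈ˡ? xs) * g z)
    ≡⟨ sumSubsets-cong (λ z → trans (factor (χ (z ≟ˢ x)) (χ (z ∈ˡ? xs)) (g z)) (cong (_* g z) (sym (χ-∈-∷ x∉xs z)))) ⟩
  sumSubsets (λ z → χ (z ∈ˡ? x ∷ xs) * g z) ∎
  where
  factor : ∀ a b c → 1ℤ * (a * c) + b * c ≡ (a + b) * c
  factor = solve-∀

-- The Euler characteristic of a simplex

-- If the first label lies in `w`, adding or removing it pairs the subsets of `w` with opposite
-- signs and everything cancels. If not, subsets containing it contribute 0 and induction applies.
-- The empty set is counted here, hence the 1 on the right.
sum-signs : (w : Subset n) →
            sumSubsets (λ z → χ (z ⊆? w) * -1ℤ ^ ∣ z ∣) ≡ 1ℤ + -1ℤ * χ (nonempty? w)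
sum-signs [] = refl
sum-signs {suc n} (inside ∷ w) = begin
  sumSubsets (λ z → χ (z ⊆? w) * (-1ℤ * -1ℤ ^ ∣ z ∣)) + S
    ≡⟨ cong (_+ S) (sumSubsets-cong (λ z → regroup (χ (z ⊆? w)) (-1ℤ ^ ∣ z ∣))) ⟩
  sumSubsets (λ z → -1ℤ * (χ (z ⊆? w) * -1ℤ ^ ∣ z ∣) + 0ℤ) + S
    ≡⟨ cong (_+ S) (sumSubsets-linear -1ℤ (λ z → χ (z ⊆? w) * -1ℤ ^ ∣ z ∣) (const 0ℤ)) ⟩
  -1ℤ * S + sumSubsets {n} (λ _ → 0ℤ) + S
    ≡⟨ cong (λ x → -1ℤ * S + x + S) (sumSubsets-zero {n} (λ _ → 0ℤ) (λ _ → refl)) ⟩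
  -1ℤ * S + 0ℤ + S
    ≡⟨ cancel S ⟩
  0ℤ ∎
  where
  S = sumSubsets (λ z → χ (z ⊆? w) * -1ℤ ^ ∣ z ∣)
  regroup : ∀ a b → a * (-1ℤ * b) ≡ -1ℤ * (a * b) + 0ℤ
  regroup = solve-∀
  cancel : ∀ a → -1ℤ * a + 0ℤ + a ≡ 0ℤ
  cancel = solve-∀
sum-signs {suc n} (outside ∷ w) = begin
  sumSubsets {n} (λ _ → 0ℤ) + S                      ≡⟨ cong (_+ S) (sumSubsets-zero {n} (λ _ → 0ℤ) (λ _ → refl)) ⟩
  0ℤ + S                                             ≡⟨ +-identityˡ S ⟩
  S                                                  ≡⟨ sum-signs w ⟩
  1ℤ + -1ℤ * χ (nonempty? w)                         ≡⟨ cong (λ x → 1ℤ + -1ℤ * x)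
                                                          (χ-cong (nonempty? w) (nonempty? (outside ∷ w)) extend restrict) ⟩
  1ℤ + -1ℤ * χ (nonempty? (outside ∷ w))             ∎
  where
  S = sumSubsets (λ z → χ (z ⊆? w) * -1ℤ ^ ∣ z ∣)
  extend : Nonempty w → Nonempty (outside ∷ w)
  extend (x , x∈w) = suc x , there x∈w
  restrict : Nonempty (outside ∷ w) → Nonempty w
  restrict (suc x , there x∈w) = x , x∈w

-- Signs, inclusion and cardinality of subsets

nonempty⇒0<∣z∣ : (z : Subset n) → Nonempty z → 0 ℕ.< ∣ z ∣
nonempty⇒0<∣z∣ {n} z (x , x∈z) = subst (ℕ._< ∣ z ∣) (∣⊥∣≡0 n) (p⊂q⇒∣p∣<∣q∣ (⊆-min z , x , x∈z , ∉⊥))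

-- Dimension is one less than cardinality. At the empty set truncation makes `dim` 0, and the
-- identity fails.
ω-nonempty : (z : Subset n) → Nonempty z → ω z ≡ -1ℤ * -1ℤ ^ ∣ z ∣
ω-nonempty z ne with ∣ z ∣ | nonempty⇒0<∣z∣ z ne
... | suc k | _ = negate (-1ℤ ^ k)
  where
  negate : ∀ a → a ≡ -1ℤ * (-1ℤ * a)
  negate = solve-∀

χ-⊆-∩ : (z x y : Subset n) → χ (z ⊆? x) * χ (z ⊆? y) ≡ χ (z ⊆? x ∩ y)
χ-⊆-∩ z x y with z ⊆? x | z ⊆? y
... | yes z⊆x | yes z⊆y = sym (χ-yes (z ⊆? x ∩ y) (λ v∈z → x∈p∩q⁺ (z⊆x v∈z , z⊆y v∈z)))
... | yes z⊆x | no z⊈y  = sym (χ-no (z ⊆? x ∩ y) (λ z⊆ → z⊈y (λ v∈z → p∩q⊆q x y (z⊆ v∈z))))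
... | no z⊈x  | d       = sym (χ-no (z ⊆? x ∩ y) (λ z⊆ → z⊈x (λ v∈z → p∩q⊆p x y (z⊆ v∈z))))

-- `_⊂_` carries an element of `q` outside `p`. A finite search finds one; if it fails, the two sets
-- are equal.
⊆∧≢⇒⊂ : {p q : Subset n} → p ⊆ q → p ≢ q → p ⊂ q
⊆∧≢⇒⊂ {p = p} {q} p⊆q p≢q with any? (λ v → v ∈? q ×-dec ¬? (v ∈? p))
... | yes (v , v∈q , v∉p) = p⊆q , v , v∈q , v∉p
... | no ∄v = contradiction (⊆-antisym p⊆q λ {v} v∈q → decidable-stable (v ∈? p) λ v∉p → ∄v (v , v∈q , v∉p)) p≢q

-- Valued in `Fin` so that it can serve as a `rank`.
cardinality : Subset n → Fin (suc n)
cardinality p = fromℕ< (s≤s (∣p∣≤n p))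

cardinality-mono : {p q : Subset n} → p ⊂ q → cardinality p <ᶠ cardinality q
cardinality-mono {p = p} {q} p⊂q
  rewrite toℕ-fromℕ< (s≤s (∣p∣≤n p)) | toℕ-fromℕ< (s≤s (∣p∣≤n q)) = p⊂q⇒∣p∣<∣q∣ p⊂q

lookup-injective : {X : Set} {xs : List X} → Unique xs → ∀ {i j} → lookup xs i ≡ lookup xs j → i ≡ j
lookup-injective (_ ∷ _)     {zero}  {zero}  eq = refl
lookup-injective (x∉xs ∷ _)  {zero}  {suc j} eq = contradiction eq (All.lookup x∉xs (∈-lookup j))
lookup-injective (x∉xs ∷ _)  {suc i} {zero}  eq = contradiction (sym eq) (All.lookup x∉xs (∈-lookup i))
lookup-injective (_ ∷ un)    {suc i} {suc j} eq = cong suc (lookup-injective un eq)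

-- Factorization of the connection matrix

module _ (G : SimplicialComplex n) where

  private
    s : Fin (size G) → Subset n
    s = simplex G

    s∈G : ∀ i → s i ∈ˡ simplices G
    s∈G = ∈-lookup

  -- For non-empty `z` within `x`, closure under subsets makes membership in `G` automatic, and
  -- `ω z` is minus the sign by cardinality. The empty set is not in `G` but is counted by
  -- `sum-signs`; the last summand corrects for it.
  signedTerm : {x : Subset n} → x ∈ˡ simplices G → ∀ y z →
               χ (z ∈ˡ? simplices G) * (χ (z ⊆? x) * (ω z * χ (z ⊆? y))) ≡
               -1ℤ * (χ (z ⊆? x ∩ y) * -1ℤ ^ ∣ z ∣) + χ (z ≟ˢ ⊥) * 1ℤ
  signedTerm {x} x∈G y z with nonempty? z
  ... | no empty = begin
    χ (z ∈ˡ? simplices G) * t                                      ≡⟨ cong (_* t) (χ-no (z ∈ˡ? simplices G) (empty ∘ nonempty G)) ⟩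
    -- This constant computes to 0: the contribution of the empty set and its correction cancel.
    -1ℤ * (1ℤ * -1ℤ ^ 0) + 1ℤ * 1ℤ                                 ≡⟨ cong₂ (λ a b → -1ℤ * (a * -1ℤ ^ b) + 1ℤ * 1ℤ)
                                                                        (χ-yes (z ⊆? x ∩ y) z⊆) (trans (cong ∣_∣ z≡⊥) (∣⊥∣≡0 n)) ⟨
    -1ℤ * (χ (z ⊆? x ∩ y) * -1ℤ ^ ∣ z ∣) + 1ℤ * 1ℤ                 ≡⟨ cong (λ a → -1ℤ * (χ (z ⊆? x ∩ y) * -1ℤ ^ ∣ z ∣) + a * 1ℤ)
                                                                        (χ-yes (z ≟ˢ ⊥) z≡⊥) ⟨
    -1ℤ * (χ (z ⊆? x ∩ y) * -1ℤ ^ ∣ z ∣) + χ (z ≟ˢ ⊥) * 1ℤ         ∎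
    where
    t = χ (z ⊆? x) * (ω z * χ (z ⊆? y))
    z≡⊥ = Empty-unique empty
    z⊆ : z ⊆ x ∩ y
    z⊆ v∈z = ⊥-elim (empty (_ , v∈z))
  ... | yes ne = begin
    χ (z ∈ˡ? simplices G) * (χ (z ⊆? x) * (ω z * χ (z ⊆? y)))      ≡⟨ absorb ⟩
    χ (z ⊆? x) * (ω z * χ (z ⊆? y))                                ≡⟨ cong (λ a → χ (z ⊆? x) * (a * χ (z ⊆? y))) (ω-nonempty z ne) ⟩
    χ (z ⊆? x) * (-1ℤ * -1ℤ ^ ∣ z ∣ * χ (z ⊆? y))                  ≡⟨ regroup (χ (z ⊆? x)) (-1ℤ ^ ∣ z ∣) (χ (z ⊆? y)) ⟩
    -1ℤ * (χ (z ⊆? x) * χ (z ⊆? y) * -1ℤ ^ ∣ z ∣) + 0ℤ * 1ℤ        ≡⟨ cong₂ (λ a b → -1ℤ * (a * -1ℤ ^ ∣ z ∣) + b * 1ℤ)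
                                                                        (χ-⊆-∩ z x y) (sym (χ-no (z ≟ˢ ⊥) z≢⊥)) ⟩
    -1ℤ * (χ (z ⊆? x ∩ y) * -1ℤ ^ ∣ z ∣) + χ (z ≟ˢ ⊥) * 1ℤ         ∎
    where
    z≢⊥ : z ≢ ⊥
    z≢⊥ refl = ∉⊥ (proj₂ ne)
    regroup : ∀ a b c → a * (-1ℤ * b * c) ≡ -1ℤ * (a * c * b) + 0ℤ * 1ℤ
    regroup = solve-∀
    absorb : χ (z ∈ˡ? simplices G) * (χ (z ⊆? x) * (ω z * χ (z ⊆? y))) ≡ χ (z ⊆? x) * (ω z * χ (z ⊆? y))
    absorb with z ⊆? x
    ... | yes z⊆x = trans (cong (_* (1ℤ * (ω z * χ (z ⊆? y)))) (χ-yes (z ∈ˡ? simplices G) (closed G x∈G ne z⊆x))) (*-identityˡ _)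
    ... | no _    = *-zeroʳ (χ (z ∈ˡ? simplices G))

  -- The zeta matrix of the simplices ordered by inclusion.
  inclusion : Matrix (size G)
  inclusion i j = χ (s i ⊆? s j)

  inclusionᵀ : Matrix (size G)
  inclusionᵀ i j = inclusion j i

  -- Summing `signedTerm` over all `z` gives minus the alternating count of all subsets of `x ∩ y`,
  -- plus 1 for the empty set; by `sum-signs` this is the indicator that `x ∩ y` is non-empty.
  connection-factorization : ∀ i j →
    connectionMatrix G i j ≡ (inclusionᵀ ⊗ (λ k l → ω (s k) * inclusion k l)) i j
  connection-factorization i j = sym (begin
    sum (λ k → χ (s k ⊆? x) * (ω (s k) * χ (s k ⊆? y)))
      ≡⟨ sum-lookup (unique G) (λ z → χ (z ⊆? x) * (ω z * χ (z ⊆? y))) ⟩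
    sumSubsets (λ z → χ (z ∈ˡ? simplices G) * (χ (z ⊆? x) * (ω z * χ (z ⊆? y))))
      ≡⟨ sumSubsets-cong (signedTerm (s∈G i) y) ⟩
    sumSubsets (λ z → -1ℤ * (χ (z ⊆? x ∩ y) * -1ℤ ^ ∣ z ∣) + χ (z ≟ˢ ⊥) * 1ℤ)
      ≡⟨ sumSubsets-linear -1ℤ (λ z → χ (z ⊆? x ∩ y) * -1ℤ ^ ∣ z ∣) (λ z → χ (z ≟ˢ ⊥ {n}) * 1ℤ) ⟩
    -1ℤ * sumSubsets (λ z → χ (z ⊆? x ∩ y) * -1ℤ ^ ∣ z ∣) + sumSubsets (λ z → χ (z ≟ˢ ⊥ {n}) * 1ℤ)
      ≡⟨ cong₂ (λ a b → -1ℤ * a + b) (sum-signs (x ∩ y)) (sumSubsets-χ≡ (⊥ {n}) (const 1ℤ)) ⟩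
    -1ℤ * (1ℤ + -1ℤ * χ (nonempty? (x ∩ y))) + 1ℤ
      ≡⟨ simplify (χ (nonempty? (x ∩ y))) ⟩
    χ (nonempty? (x ∩ y)) ∎)
    where
    x = s i
    y = s j
    simplify : ∀ a → -1ℤ * (1ℤ + -1ℤ * a) + 1ℤ ≡ a
    simplify = solve-∀

  inclusion-diagonal : ∀ i → inclusion i i ≡ 1ℤ
  inclusion-diagonal i = χ-yes (s i ⊆? s i) ⊆-refl

  inclusion-no : ∀ {i j} → i ≢ j → ¬ (s i ⊂ s j) → inclusion i j ≡ 0ℤ
  inclusion-no {i} {j} i≢j i⊄j = χ-no (s i ⊆? s j) λ i⊆j → i⊄j (⊆∧≢⇒⊂ i⊆j (i≢j ∘ lookup-injective (unique G)))

  det-connectionMatrix : det (connectionMatrix G) ≡ φ G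
  det-connectionMatrix = begin
    det (connectionMatrix G)                                    ≡⟨ det-cong connection-factorization ⟩
    -- A non-zero off-diagonal entry of `inclusionᵀ` at `i`, `j` forces `s j ⊂ s i`, so row `i`
    -- draws only on rows of smaller cardinality.
    det (inclusionᵀ ⊗ (λ k l → ω (s k) * inclusion k l))        ≡⟨ det-unitriangular-⊗ (cardinality ∘ s) inclusionᵀ _ inclusion-diagonal
                                                                     (λ i≢j ≮ → inclusion-no (i≢j ∘ sym) (≮ ∘ cardinality-mono)) ⟩
    det (λ k l → ω (s k) * inclusion k l)                       ≡⟨ det-scaleRows ω (simplices G) inclusion ⟩
    -- `inclusion` is triangular in the opposite direction; complements reverse strict inclusion, so
    -- their cardinality is the suitable rank.
    φ G * det inclusion                                         ≡⟨ cong (φ G *_) (det-unitriangular (cardinality ∘ ∁ ∘ s) inclusion inclusion-diagonal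
                                                                     (λ i≢j ≮ → inclusion-no i≢j (≮ ∘ cardinality-mono ∘ p⊂q⇒∁p⊃∁q))) ⟩
    φ G * 1ℤ                                                    ≡⟨ *-identityʳ _ ⟩
    φ G                                                         ∎

-- The Fermi characteristic is a sign

-1^k≡±1 : ∀ k → -1ℤ ^ k ≡ -1ℤ ⊎ -1ℤ ^ k ≡ 1ℤ
-1^k≡±1 zero    = inj₂ refl
-1^k≡±1 (suc k) with -1^k≡±1 k
... | inj₁ eq = inj₂ (cong (-1ℤ *_) eq)
... | inj₂ eq = inj₁ (cong (-1ℤ *_) eq)

product-ω≡±1 : (xs : List (Subset n)) → let P = foldr _*_ 1ℤ (map ω xs) in P ≡ -1ℤ ⊎ P ≡ 1ℤ
product-ω≡±1 []       = inj₂ refl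
product-ω≡±1 (x ∷ xs) with -1^k≡±1 (dim x) | product-ω≡±1 xs
... | inj₁ a | inj₁ b = inj₂ (cong₂ _*_ a b)
... | inj₁ a | inj₂ b = inj₁ (cong₂ _*_ a b)
... | inj₂ a | inj₁ b = inj₁ (cong₂ _*_ a b)
... | inj₂ a | inj₂ b = inj₂ (cong₂ _*_ a b)

theorem1 : (n : ℕ) (G : SimplicialComplex n) → (det (connectionMatrix G) ≡ φ G) × (φ G ≡ -1ℤ ⊎ φ G ≡ 1ℤ)
theorem1 n G = det-connectionMatrix G , product-ω≡±1 (simplices G)
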